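{- For every integer $\ell \geq 2$ there is a constant $C > 0$ such that \[ f(r, C_{2\ell}) \leq C\, r^{\frac{3\ell-2}{3\ell+2}} (\log r)^{\frac{3\ell}{3\ell+2}} \] for infinitely many positive integers $r$.
   Context: Let $r,k$ be positive integers. A graph $G$ is an $(r,k)$-graph if $V(G)$ can be partitioned into sets $V_1,\dots,V_r$ with $|V_i| \le k$ for all $i$ such that for every pair $i \neq j$ in $[r]$ there is an edge of $G$ with one endpoint in $V_i$ and the other in $V_j$. For a graph $H$, $f(r,H)$ is the minimum $k$ such that there exists an $H$-free $(r,k)$-graph. $C_{2\ell}$ denotes the cycle of length $2\ell$. -}

module Defs where

open import Data.Nat using (ℕ; zero; suc; _≤_; _*_; _+_; _∸_; _^_)
open import Data.Fin using (Fin; zero; suc; inject₁; fromℕ)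
open import Data.Fin.Properties using (_≟_)
open import Data.List using (length; filter)
open import Data.List using (List)
open import Data.Product using (Σ; ∃; ∃-syntax; _×_)
open import Data.Empty using (⊥)
open import Relation.Nullary using (¬_)
open import Relation.Binary.PropositionalEquality using (_≡_)
open import Function.Definitions using (Injective)
import Data.List.Base as L
open import Data.Fin using (toℕ)

record Graph (n : ℕ) : Set₁ where
  field
    Adj     : Fin n → Fin n → Set
    sym     : ∀ {u v} → Adj u v → Adj v u
    irrefl  : ∀ {v} → ¬ Adj v v

open Graph public

allFin : (n : ℕ) → List (Fin n)
allFin n = L.tabulate (λ i → i)

ContainsCycle : ∀ {n} → Graph n → ℕ → Set
ContainsCycle {n} G zero = ⊥   -- no cycle of length 0 (only lengths 2ℓ ≥ 4 are used)
ContainsCycle {n} G (suc m) =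
  ∃[ c ] (Injective _≡_ _≡_ c
          × (∀ (j : Fin m) → Adj G (c (inject₁ j)) (c (suc j)))
          × Adj G (c (fromℕ m)) (c zero))

CycleFree : ∀ {n} → Graph n → ℕ → Set
CycleFree G L = ¬ ContainsCycle G L

partSize : ∀ {n r} → (Fin n → Fin r) → Fin r → ℕ
partSize {n} p i = length (filter (λ v → p v ≟ i) (allFin n))

IsRKPartition : ∀ {n} → Graph n → (r k : ℕ) → (Fin n → Fin r) → Set
IsRKPartition {n} G r k p =
  (∀ i → partSize p i ≤ k)
  × (∀ (i j : Fin r) → ¬ i ≡ j →
       ∃[ u ] ∃[ v ] (Adj G u v × p u ≡ i × p v ≡ j))

ExistsCycleFreeRKGraph : (r k L : ℕ) → Set₁
ExistsCycleFreeRKGraph r k L =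
  ∃[ n ] Σ (Graph n) (λ G → CycleFree G L × ∃[ p ] IsRKPartition G r k p)

{-# OPTIONS --safe #-}

-- Let q be prime.  An edge is a matrix (α β ; γ δ) of determinant 1 over F_q[x],
-- truncated at a suitable power of x, with α(0) = δ(0) = 1 and γ(0) = 0.  Its point is
-- its coset modulo right multiplication by the matrices (1 a ; 0 1), its line is its
-- coset modulo the matrices (1 0 ; bx 1).  Two edges at a point differ by adding a
-- multiple of the column (α , γ) to (β , δ); two edges at a line differ by adding a
-- multiple of x (β , δ) to (α , γ).  Hence the determinants of the columns met along a
-- path with the column (β , δ) of its first line satisfy a continuant recurrence with
-- nonzero coefficients, and their degree grows by one in every two steps.  In a cycle of
-- length 2ℓ some vertex is reached from one line in ℓ - 1 and in ℓ + 1 steps, so one of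
-- its coefficients would be both zero and nonzero.
--
-- As δ is determined by α, β and γ, there are q^(2a) edges where 4a ≤ 3ℓ + 2.  The 2a
-- coordinates can be shared out so that a of them depend on the point only, the others
-- depend on the line only, and any values of both kinds belong to exactly one edge.
-- Taking these as labels gives r = q^a parts of 2 q^(a-1) vertices, and every pair of
-- labels is joined; no logarithm is lost.
module Submission where

open import Defs hiding (sym; allFin)
open import Data.Nat as ℕ using (ℕ; zero; suc; z≤n; s≤s; _≤_; _<_; NonZero)
import Data.Nat.Properties as ℕ
import Data.Nat.Divisibility as ℕ
open import Data.Nat.Primality using (Prime; euclidsLemma; prime⇒nonZero; prime⇒nonTrivial; ¬prime[1])
open import Data.Fin as Fin using (Fin; toℕ; fromℕ<; finToFun; funToFin; combine; quotient; remainder)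
import Data.Fin.Properties as Fin
open import Data.Product using (_×_; _,_; proj₁; proj₂; ∃-syntax)
open import Data.Sum as Sum using (_⊎_; inj₁; inj₂; [_,_]′; swap)
open import Function using (_∘_; id)
open import Function.Definitions using (Injective)
open import Relation.Binary.PropositionalEquality
  using (_≡_; _≢_; refl; sym; trans; cong; cong₂; subst; subst₂; module ≡-Reasoning)
open import Relation.Nullary using (¬_; yes; no; contradiction)

-- Coordinates of an edge: γ₁ … γₘ, β₀ … βₕ₋₁ and α₁ … α_{c+d}, where m = ⌊ℓ/2⌋.  Point
-- labels consist of the γₙ and c coordinates α, line labels of the βₙ and d coordinates α.
record Parameters (ℓ : ℕ) : Set where
  field
    {m₀ h₀ c d} : ℕ
    h+d≡m+c : suc h₀ ℕ.+ d ≡ suc m₀ ℕ.+ c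
    m≤c+d   : suc m₀ ≤ c ℕ.+ d
    m≤h     : m₀ ≤ h₀
    h≤1+m   : h₀ ≤ suc m₀
    halves  : ℓ ≡ suc m₀ ℕ.* 2 ⊎ (suc m₀ < suc h₀ × ℓ ≡ suc (suc m₀ ℕ.* 2))
    size    : 4 ℕ.* (suc m₀ ℕ.+ c) ≤ 3 ℕ.* ℓ ℕ.+ 2

  m h : ℕ
  m = suc m₀
  h = suc h₀

-- Alternating walks in terms of labels.

module Walks {r S : ℕ} (s t : Fin r → Fin r → Fin S) where

  -- Only labels are recorded: a vertex is a label together with a value of `s` (points) or `t`
  -- (lines). So `at-point` and `at-line` say that consecutive edges share a vertex, and the last
  -- two fields exclude backtracking.
  record Walk : Set where
    field
      line point    : ℕ → Fin r
      at-point      : ∀ k → s (point k) (line k) ≡ s (point k) (line (suc k))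
      at-line       : ∀ k → t (point k) (line (suc k)) ≡ t (point (suc k)) (line (suc k))
      lines-differ  : ∀ k → line k ≢ line (suc k)
      points-differ : ∀ k → point k ≢ point (suc k)

  SameStart : Walk → Walk → Set
  SameStart F G = G.line 0 ≡ F.line 0 × t (F.point 0) (F.line 0) ≡ t (G.point 0) (G.line 0)
    where
    module F = Walk F
    module G = Walk G

  MeetAtPoint : (F G : Walk) → ℕ → ℕ → Set
  MeetAtPoint F G k l = G.point l ≡ F.point k × s (F.point k) (F.line k) ≡ s (G.point l) (G.line l)
    where
    module F = Walk F
    module G = Walk G

  MeetAtLine : (F G : Walk) → ℕ → ℕ → Set
  MeetAtLine F G k l = G.line l ≡ F.line k × t (F.point k) (F.line k) ≡ t (G.point l) (G.line l)
    where
    module F = Walk F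
    module G = Walk G

module PowerSeries where

  open import Data.Integer using (ℤ; 0ℤ; 1ℤ; +_; _+_; _*_; -_; _-_; ∣_∣)
  import Data.Integer.Properties as ℤ
  open import Data.Integer.DivMod using (_%ℕ_; _/ℕ_; n%ℕd<d; a≡a%ℕn+[a/ℕn]*n)
  open import Data.Integer.Divisibility.Signed
    using (_∣_; divides; ∣⇒∣ᵤ; ∣ᵤ⇒∣; ∣m∣n⇒∣m+n; ∣m⇒∣m*n; ∣n⇒∣m*n; ∣m⇒∣-m)
  open import Data.Integer.Tactic.RingSolver using (solve-∀)
  open import Level using (0ℓ)
  open import Relation.Binary.Bundles using (Setoid)
  import Relation.Binary.Reasoning.Setoid as SetoidReasoning

  -- Arithmetic modulo q.

  module Congruence (q : ℕ) where

    infix 4 _≈_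

    -- A record rather than an abbreviation, so that x and y can be inferred.
    record _≈_ (x y : ℤ) : Set where
      constructor mk≈
      field diff : + q ∣ x - y

    open _≈_ public

    ≈-reflexive : ∀ {x y} → x ≡ y → x ≈ y
    ≈-reflexive {x} refl = mk≈ (divides 0ℤ (ℤ.+-inverseʳ x))

    ≈-refl : ∀ {x} → x ≈ x
    ≈-refl = ≈-reflexive refl

    ≈-sym : ∀ {x y} → x ≈ y → y ≈ x
    ≈-sym {x} {y} (mk≈ d) = mk≈ (subst (+ q ∣_) (lemma x y) (∣m⇒∣-m d))
      where
      lemma : ∀ x y → - (x - y) ≡ y - x
      lemma = solve-∀

    ≈-trans : ∀ {x y z} → x ≈ y → y ≈ z → x ≈ z
    ≈-trans {x} {y} {z} (mk≈ d) (mk≈ e) = mk≈ (subst (+ q ∣_) (lemma x y z) (∣m∣n⇒∣m+n d e))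
      where
      lemma : ∀ x y z → (x - y) + (y - z) ≡ x - z
      lemma = solve-∀

    setoid : Setoid 0ℓ 0ℓ
    setoid = record
      { Carrier = ℤ ; _≈_ = _≈_
      ; isEquivalence = record { refl = ≈-refl ; sym = ≈-sym ; trans = ≈-trans } }

    +-cong : ∀ {x x′ y y′} → x ≈ x′ → y ≈ y′ → x + y ≈ x′ + y′
    +-cong {x} {x′} {y} {y′} (mk≈ d) (mk≈ e) = mk≈ (subst (+ q ∣_) (lemma x x′ y y′) (∣m∣n⇒∣m+n d e))
      where
      lemma : ∀ x x′ y y′ → (x - x′) + (y - y′) ≡ (x + y) - (x′ + y′)
      lemma = solve-∀

    *-cong : ∀ {x x′ y y′} → x ≈ x′ → y ≈ y′ → x * y ≈ x′ * y′
    *-cong {x} {x′} {y} {y′} (mk≈ d) (mk≈ e) =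
      mk≈ (subst (+ q ∣_) (lemma x x′ y y′) (∣m∣n⇒∣m+n (∣m⇒∣m*n y d) (∣n⇒∣m*n x′ e)))
      where
      lemma : ∀ x x′ y y′ → (x - x′) * y + x′ * (y - y′) ≡ x * y - x′ * y′
      lemma = solve-∀

    neg-cong : ∀ {x x′} → x ≈ x′ → - x ≈ - x′
    neg-cong {x} {x′} (mk≈ d) = mk≈ (subst (+ q ∣_) (lemma x x′) (∣m⇒∣-m d))
      where
      lemma : ∀ x x′ → - (x - x′) ≡ - x - - x′
      lemma = solve-∀

    -‿cong : ∀ {x x′ y y′} → x ≈ x′ → y ≈ y′ → x - y ≈ x′ - y′
    -‿cong p r = +-cong p (neg-cong r)

  module _ {q} (q-prime : Prime q) where
    open Congruence q

    prime⇒noZeroDivisors : ∀ x y → x * y ≈ 0ℤ → x ≈ 0ℤ ⊎ y ≈ 0ℤ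
    prime⇒noZeroDivisors x y (mk≈ d) = Sum.map zero⁺ zero⁺ (euclidsLemma ∣ x ∣ ∣ y ∣ q-prime
      (subst (q ℕ.∣_) (trans (cong ∣_∣ (ℤ.+-identityʳ (x * y))) (ℤ.abs-* x y)) (∣⇒∣ᵤ d)))
      where
      zero⁺ : ∀ {z} → q ℕ.∣ ∣ z ∣ → z ≈ 0ℤ
      zero⁺ {z} q∣z = mk≈ (∣ᵤ⇒∣ (subst (λ w → q ℕ.∣ ∣ w ∣) (sym (ℤ.+-identityʳ z)) q∣z))

    prime⇒1≉0 : ¬ 1ℤ ≈ 0ℤ
    prime⇒1≉0 (mk≈ d) = ¬prime[1] (subst Prime (ℕ.∣1⇒≡1 (∣⇒∣ᵤ d)) q-prime)

  -- Power series and their truncations.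

  Series : Set
  Series = ℕ → ℤ

  infixr 8 x·_
  x·_ : Series → Series
  (x· f) zero    = 0ℤ
  (x· f) (suc n) = f n

  one : Series
  one zero    = 1ℤ
  one (suc _) = 0ℤ

  -- The Cauchy product, summed from the constant coefficient of `g` upwards so that no subtraction
  -- of indices occurs.
  conv : Series → Series → Series
  conv f g zero    = f 0 * g 0
  conv f g (suc n) = f (suc n) * g 0 + conv f (g ∘ suc) n

  conv-minusʳ : ∀ f g h c n → conv f (λ k → g k - c * h k) n ≡ conv f g n - c * conv f h n
  conv-minusʳ f g h c zero    = lemma (f 0) (g 0) (h 0) c
    where
    lemma : ∀ f g h c → f * (g - c * h) ≡ f * g - c * (f * h)
    lemma = solve-∀
  conv-minusʳ f g h c (suc n) = trans
    (cong (_+_ (f (suc n) * (g 0 - c * h 0))) (conv-minusʳ f (g ∘ suc) (h ∘ suc) c n))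
    (lemma (f (suc n)) (g 0) (h 0) c (conv f (g ∘ suc) n) (conv f (h ∘ suc) n))
    where
    lemma : ∀ f g h c u v → f * (g - c * h) + (u - c * v) ≡ (f * g + u) - c * (f * h + v)
    lemma = solve-∀

  conv-minusˡ : ∀ f g h c n → conv (λ k → f k - c * h k) g n ≡ conv f g n - c * conv h g n
  conv-minusˡ f g h c zero    = lemma (f 0) (g 0) (h 0) c
    where
    lemma : ∀ f g h c → (f - c * h) * g ≡ f * g - c * (h * g)
    lemma = solve-∀
  conv-minusˡ f g h c (suc n) = trans
    (cong (_+_ ((f (suc n) - c * h (suc n)) * g 0)) (conv-minusˡ f (g ∘ suc) h c n))
    (lemma (f (suc n)) (g 0) (h (suc n)) c (conv f (g ∘ suc) n) (conv h (g ∘ suc) n))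
    where
    lemma : ∀ f g h c u v → (f - c * h) * g + (u - c * v) ≡ (f * g + u) - c * (h * g + v)
    lemma = solve-∀

  conv-xʳ : ∀ f g n → conv f (x· g) n ≡ (x· conv f g) n
  conv-xʳ f g zero    = ℤ.*-zeroʳ (f 0)
  conv-xʳ f g (suc n) = trans (cong (_+ conv f g n) (ℤ.*-zeroʳ (f (suc n)))) (ℤ.+-identityˡ _)

  conv-xˡ : ∀ f g n → conv (x· f) g n ≡ (x· conv f g) n
  conv-xˡ f g zero          = ℤ.*-zeroˡ (g 0)
  conv-xˡ f g (suc zero)    = trans (cong (_+_ (f 0 * g 0)) (ℤ.*-zeroˡ (g 1))) (ℤ.+-identityʳ _)
  conv-xˡ f g (suc (suc n)) = cong (_+_ (f (suc n) * g 0)) (conv-xˡ f (g ∘ suc) (suc n))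

  -- Long division; a quotient only if the divisor has constant coefficient 1.
  infixl 7 _÷_
  _÷_ : Series → Series → Series
  (f ÷ g) zero    = f 0
  (f ÷ g) (suc n) = ((λ k → f (suc k) - f 0 * g (suc k)) ÷ g) n

  conv-÷ : ∀ f g → g 0 ≡ 1ℤ → ∀ n → conv g (f ÷ g) n ≡ f n
  conv-÷ f g g₀ zero    = trans (cong (_* f 0) g₀) (ℤ.*-identityˡ (f 0))
  conv-÷ f g g₀ (suc n) = trans
    (cong (_+_ (g (suc n) * f 0)) (conv-÷ (λ k → f (suc k) - f 0 * g (suc k)) g g₀ n))
    (lemma (g (suc n)) (f 0) (f (suc n)))
    where
    lemma : ∀ g f₀ f → g * f₀ + (f - f₀ * g) ≡ f
    lemma = solve-∀

  splice : ℕ → Series → Series → Series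
  splice zero    f g n       = g n
  splice (suc c) f g zero    = f 0
  splice (suc c) f g (suc n) = splice c (f ∘ suc) g n

  splice-< : ∀ c f g {n} → n < c → splice c f g n ≡ f n
  splice-< (suc c) f g {zero}  _         = refl
  splice-< (suc c) f g {suc n} (s≤s n<c) = splice-< c (f ∘ suc) g n<c

  splice-+ : ∀ c f g n → splice c f g (c ℕ.+ n) ≡ g n
  splice-+ zero    f g n = refl
  splice-+ (suc c) f g n = splice-+ c (f ∘ suc) g n

  <-or-+ : ∀ c n → n < c ⊎ ∃[ k ] n ≡ c ℕ.+ k
  <-or-+ c n with n ℕ.<? c
  ... | yes n<c = inj₁ n<c
  ... | no  n≮c = inj₂ (n ℕ.∸ c , sym (ℕ.m+[n∸m]≡n (ℕ.≮⇒≥ n≮c)))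

  module SeriesCongruence (q : ℕ) where
    open Congruence q public

    infix 4 _≈[_]_
    _≈[_]_ : Series → ℕ → Series → Set
    f ≈[ N ] g = ∀ {n} → n < N → f n ≈ g n

    +-cancelˡ : ∀ {x y x′ y′} → x ≈ x′ → x + y ≈ x′ + y′ → y ≈ y′
    +-cancelˡ {x} {y} {x′} {y′} x≈ s≈ = ≈-trans (≈-reflexive (lemma x y))
      (≈-trans (-‿cong s≈ x≈) (≈-reflexive (sym (lemma x′ y′))))
      where
      lemma : ∀ x y → y ≡ (x + y) - x
      lemma = solve-∀

    conv-cong : ∀ {N} f f′ g g′ → f ≈[ N ] f′ → g ≈[ N ] g′ → conv f g ≈[ N ] conv f′ g′
    conv-cong f f′ g g′ f≈ g≈ {zero}  n<N = *-cong (f≈ n<N) (g≈ n<N)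
    conv-cong {suc N} f f′ g g′ f≈ g≈ {suc n} (s≤s n<N) = +-cong
      (*-cong (f≈ (s≤s n<N)) (g≈ (s≤s z≤n)))
      (conv-cong f f′ (g ∘ suc) (g′ ∘ suc) (λ k<N → f≈ (ℕ.m≤n⇒m≤1+n k<N)) (λ k<N → g≈ (s≤s k<N)) n<N)

    -- A series with constant coefficient 1 is a unit, also modulo x^N: the constant coefficients of
    -- `g` and `g′` agree, and cancelling their contribution leaves the same problem for the shifted
    -- series.
    conv-cancelˡ : ∀ {N} f g g′ → f 0 ≡ 1ℤ → conv f g ≈[ N ] conv f g′ → g ≈[ N ] g′
    conv-cancelˡ {suc N} f g g′ f₀ eq {n} (s≤s n≤N) = go n n≤N
      where
      at0 : g 0 ≈ g′ 0
      at0 = ≈-trans (≈-reflexive (sym (unit (g 0)))) (≈-trans (eq (s≤s z≤n)) (≈-reflexive (unit (g′ 0))))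
        where
        unit : ∀ y → f 0 * y ≡ y
        unit y = trans (cong (_* y) f₀) (ℤ.*-identityˡ y)
      go : ∀ n → n ≤ N → g n ≈ g′ n
      go zero    _   = at0
      go (suc n) n<N = conv-cancelˡ {N} f (g ∘ suc) (g′ ∘ suc) f₀
        (λ {k} k<N → +-cancelˡ (*-cong (≈-refl {f (suc k)}) at0) (eq (s≤s k<N))) n<N

    x·-cong : ∀ {N} f g → f ≈[ N ] g → x· f ≈[ suc N ] x· g
    x·-cong f g f≈g {zero}  _         = ≈-refl
    x·-cong f g f≈g {suc n} (s≤s n<N) = f≈g n<N

  -- Labels as strings of base-q digits.

  funToFin-cong : ∀ {a q} {f g : Fin a → Fin q} → (∀ k → f k ≡ g k) → funToFin f ≡ funToFin g
  funToFin-cong {zero}  f≗g = refl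
  funToFin-cong {suc a} f≗g = cong₂ Fin.combine (f≗g Fin.zero) (funToFin-cong (f≗g ∘ Fin.suc))

  module Digits (q : ℕ) .{{_ : NonZero q}} where
    open SeriesCongruence q public

    residue : ℤ → Fin q
    residue x = fromℕ< (n%ℕd<d x q)

    residue-injective : ∀ {x y} → residue x ≡ residue y → x ≈ y
    residue-injective {x} {y} eq = mk≈ (divides (x /ℕ q - y /ℕ q) (begin
      x - y
        ≡⟨ cong₂ _-_ (a≡a%ℕn+[a/ℕn]*n x q) (a≡a%ℕn+[a/ℕn]*n y q) ⟩
      (+ (x %ℕ q) + x /ℕ q * + q) - (+ (y %ℕ q) + y /ℕ q * + q)
        ≡⟨ cong (λ r → (+ r + x /ℕ q * + q) - (+ (y %ℕ q) + y /ℕ q * + q)) %-eq ⟩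
      (+ (y %ℕ q) + x /ℕ q * + q) - (+ (y %ℕ q) + y /ℕ q * + q)
        ≡⟨ lemma (+ (y %ℕ q)) (x /ℕ q) (y /ℕ q) (+ q) ⟩
      (x /ℕ q - y /ℕ q) * + q ∎))
      where
      open ≡-Reasoning
      %-eq : x %ℕ q ≡ y %ℕ q
      %-eq = trans (sym (Fin.toℕ-fromℕ< (n%ℕd<d x q))) (trans (cong toℕ eq) (Fin.toℕ-fromℕ< (n%ℕd<d y q)))
      lemma : ∀ r a b q → (r + a * q) - (r + b * q) ≡ (a - b) * q
      lemma = solve-∀

    -- Two digits differ by less than q in absolute value, so a difference divisible by q is 0.
    +toℕ-injective : ∀ {x y : Fin q} → + toℕ x ≈ + toℕ y → x ≡ y
    +toℕ-injective {x} {y} (mk≈ d) = Fin.toℕ-injective (ℤ.+-injective (ℤ.i-j≡0⇒i≡j _ _ (ℤ.∣i∣≡0⇒i≡0 ∣x-y∣≡0)))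
      where
      ∣x-y∣<q : ∣ + toℕ x - + toℕ y ∣ < q
      ∣x-y∣<q = ℕ.≤-<-trans
        (ℕ.≤-trans (ℕ.≤-reflexive (cong ∣_∣ (ℤ.m-n≡m⊖n (toℕ x) (toℕ y)))) (ℤ.∣m⊝n∣≤m⊔n (toℕ x) (toℕ y)))
        (ℕ.⊔-lub (Fin.toℕ<n x) (Fin.toℕ<n y))
      ∣x-y∣≡0 : ∣ + toℕ x - + toℕ y ∣ ≡ 0
      ∣x-y∣≡0 with ∣ + toℕ x - + toℕ y ∣ | ∣x-y∣<q | ∣⇒∣ᵤ d
      ... | zero  | _   | _  = refl
      ... | suc _ | s<q | q∣ = contradiction (ℕ.∣⇒≤ q∣) (ℕ.<⇒≱ s<q)

    digit : ∀ a → Fin (q ℕ.^ a) → Series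
    digit a i n with n ℕ.<? a
    ... | yes n<a = + toℕ (finToFun {q} {a} i (fromℕ< n<a))
    ... | no  _   = 0ℤ

    digit-toℕ : ∀ a (i : Fin (q ℕ.^ a)) k → digit a i (toℕ k) ≡ + toℕ (finToFun {q} {a} i k)
    digit-toℕ a i k with toℕ k ℕ.<? a
    ... | yes k<a = cong (+_ ∘ toℕ ∘ finToFun {q} {a} i) (Fin.fromℕ<-toℕ k k<a)
    ... | no  k≮a = contradiction (Fin.toℕ<n k) k≮a

    digit-injective : ∀ a {i i′ : Fin (q ℕ.^ a)} → digit a i ≈[ a ] digit a i′ → i ≡ i′
    digit-injective a {i} {i′} eq = begin
      i                              ≡⟨ Fin.funToFin-finToFin {a} {q} i ⟨
      funToFin (finToFun {q} {a} i)  ≡⟨ funToFin-cong same ⟩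
      funToFin (finToFun {q} {a} i′) ≡⟨ Fin.funToFin-finToFin {a} {q} i′ ⟩
      i′                             ∎
      where
      open ≡-Reasoning
      same : ∀ k → finToFun {q} {a} i k ≡ finToFun {q} {a} i′ k
      same k = +toℕ-injective (≈-trans (≈-reflexive (sym (digit-toℕ a i k)))
        (≈-trans (eq (Fin.toℕ<n k)) (≈-reflexive (digit-toℕ a i′ k))))

    pack : ∀ a → Series → Fin (q ℕ.^ a)
    pack a f = funToFin {a} (residue ∘ f ∘ toℕ)

    pack-injective : ∀ {a} f g → pack a f ≡ pack a g → f ≈[ a ] g
    pack-injective {a} f g eq {n} n<a = subst (λ k → f k ≈ g k) (Fin.toℕ-fromℕ< n<a) (residue-injective (begin
      residue (f (toℕ (fromℕ< n<a)))   ≡⟨ Fin.finToFun-funToFin (residue ∘ f ∘ toℕ) (fromℕ< n<a) ⟨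
      finToFun (pack a f) (fromℕ< n<a) ≡⟨ cong (λ i → finToFun i (fromℕ< n<a)) eq ⟩
      finToFun (pack a g) (fromℕ< n<a) ≡⟨ Fin.finToFun-funToFin (residue ∘ g ∘ toℕ) (fromℕ< n<a) ⟩
      residue (g (toℕ (fromℕ< n<a)))   ∎))
      where open ≡-Reasoning

  -- Coordinates of edges, points and lines.

  module Coordinates (q : ℕ) .{{_ : NonZero q}} {ℓ} (P : Parameters ℓ) where

    open Parameters P
    open Digits q public

    a : ℕ
    a = m ℕ.+ c

    Label Rest : Set
    Label = Fin (q ℕ.^ a)
    Rest  = Fin (q ℕ.^ (m₀ ℕ.+ c))

    -- The first m digits of a point label are coefficients of γ, the other c belong to α. The
    -- latter reappear here beyond x^m, which is harmless: different points are compared in γ only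
    -- modulo x^(m+1).
    γ : Label → Series
    γ i = x· digit a i

    -- Padded with zeros, because `α⁺` may read β beyond the h coefficients that the label
    -- prescribes.
    β : Label → Series
    β j = splice h (digit a j) (λ _ → 0ℤ)

    -- The superscripts ᴾ and ᴸ mark coset representatives: βᴾ and δᴾ depend on the point
    -- only, being normalised by βᴾ(0) = 0; αᴸ and γᴸ depend on the line only, being
    -- normalised by γᴸ₁ = 0.  For n > c, the label j prescribes αᴸₙ rather than αₙ.
    α⁺ α δ αᴸ γᴸ βᴾ δᴾ : Label → Label → Series
    α⁺ i j = splice c (λ n → digit a i (m ℕ.+ n)) (λ n → digit a j (h ℕ.+ n) + γ i 1 * β j (c ℕ.+ n))
    α i j zero    = 1ℤ
    α i j (suc n) = α⁺ i j n
    δ i j = (λ n → one n + conv (β j) (γ i) n) ÷ α i j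
    αᴸ i j n = α i j n - γ i 1 * (x· β j) n
    γᴸ i j n = γ i n - γ i 1 * (x· δ i j) n
    βᴾ i j n = β j n - β j 0 * α i j n
    δᴾ i j n = δ i j n - β j 0 * γ i n

    -- The coordinates of the point (line) of an edge that are not in its label.
    sˢ tˢ : Label → Label → Series
    sˢ i j = splice d (λ n → α i j (suc (c ℕ.+ n))) (λ n → βᴾ i j (suc n))
    tˢ i j = splice c (λ n → αᴸ i j (suc n)) (λ n → γᴸ i j (suc (suc n)))

    s t : Label → Label → Rest
    s i j = pack (m₀ ℕ.+ c) (sˢ i j)
    t i j = pack (m₀ ℕ.+ c) (tˢ i j)

    det : ∀ i j n → conv (α i j) (δ i j) n ≡ one n + conv (β j) (γ i) n
    det i j = conv-÷ _ (α i j) refl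

    -- Both kinds of vertex have equally many coordinates outside the label: d of α and h₀ of βᴾ for
    -- a point, c of αᴸ and m₀ of γᴸ for a line.
    d+h₀≡m₀+c : d ℕ.+ h₀ ≡ m₀ ℕ.+ c
    d+h₀≡m₀+c = trans (ℕ.+-comm d h₀) (ℕ.suc-injective h+d≡m+c)

    -- Column operations preserve the determinant; here β(0) times the first column is subtracted
    -- from the second.
    detᴾ : ∀ i j n → conv (α i j) (δᴾ i j) n ≡ one n + conv (βᴾ i j) (γ i) n
    detᴾ i j n = begin
      conv (α i j) (δᴾ i j) n ≡⟨ conv-minusʳ (α i j) (δ i j) (γ i) (β j 0) n ⟩
      conv (α i j) (δ i j) n - β j 0 * conv (α i j) (γ i) n ≡⟨ cong (_- β j 0 * conv (α i j) (γ i) n) (det i j n) ⟩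
      one n + conv (β j) (γ i) n - β j 0 * conv (α i j) (γ i) n ≡⟨ ℤ.+-assoc (one n) _ _ ⟩
      one n + (conv (β j) (γ i) n - β j 0 * conv (α i j) (γ i) n)
        ≡⟨ cong (_+_ (one n)) (conv-minusˡ (β j) (γ i) (α i j) (β j 0) n) ⟨
      one n + conv (βᴾ i j) (γ i) n ∎
      where open ≡-Reasoning

    detᴸ : ∀ i j n → conv (αᴸ i j) (δ i j) n ≡ one n + conv (β j) (γᴸ i j) n
    detᴸ i j n = begin
      conv (αᴸ i j) (δ i j) n ≡⟨ conv-minusˡ (α i j) (δ i j) (x· β j) b n ⟩
      conv (α i j) (δ i j) n - b * conv (x· β j) (δ i j) n
        ≡⟨ cong₂ (λ u v → u - b * v) (det i j n) (trans (conv-xˡ (β j) (δ i j) n) (sym (conv-xʳ (β j) (δ i j) n))) ⟩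
      one n + conv (β j) (γ i) n - b * conv (β j) (x· δ i j) n ≡⟨ ℤ.+-assoc (one n) _ _ ⟩
      one n + (conv (β j) (γ i) n - b * conv (β j) (x· δ i j) n)
        ≡⟨ cong (_+_ (one n)) (conv-minusʳ (β j) (γ i) (x· δ i j) b n) ⟨
      one n + conv (β j) (γᴸ i j) n ∎
      where
      open ≡-Reasoning
      b = γ i 1

    αᴸ₀ : ∀ i j → αᴸ i j 0 ≡ 1ℤ
    αᴸ₀ i j = cong (_-_ 1ℤ) (ℤ.*-zeroʳ (γ i 1))

    α-low : ∀ i j {n} → n < c → α i j (suc n) ≡ digit a i (m ℕ.+ n)
    α-low i j = splice-< c _ _

    β-low : ∀ j {n} → n < h → β j n ≡ digit a j n
    β-low j = splice-< h (digit a j) _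

    β-high : ∀ j n → β j (h ℕ.+ n) ≡ 0ℤ
    β-high j = splice-+ h (digit a j) (λ _ → 0ℤ)

    sˢ-low : ∀ i j {n} → n < d → sˢ i j n ≡ α i j (suc (c ℕ.+ n))
    sˢ-low i j = splice-< d _ _

    sˢ-high : ∀ i j n → sˢ i j (d ℕ.+ n) ≡ βᴾ i j (suc n)
    sˢ-high i j = splice-+ d (λ n → α i j (suc (c ℕ.+ n))) (λ n → βᴾ i j (suc n))

    tˢ-low : ∀ i j {n} → n < c → tˢ i j n ≡ αᴸ i j (suc n)
    tˢ-low i j = splice-< c _ _

    tˢ-high : ∀ i j n → tˢ i j (c ℕ.+ n) ≡ γᴸ i j (suc (suc n))
    tˢ-high i j = splice-+ c (λ n → αᴸ i j (suc n)) (λ n → γᴸ i j (suc (suc n)))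

    αᴸ-free : ∀ i j n → αᴸ i j (suc (c ℕ.+ n)) ≡ digit a j (h ℕ.+ n)
    αᴸ-free i j n = trans
      (cong (_- γ i 1 * β j (c ℕ.+ n))
        (splice-+ c (λ k → digit a i (m ℕ.+ k)) (λ k → digit a j (h ℕ.+ k) + γ i 1 * β j (c ℕ.+ k)) n))
      (lemma (digit a j (h ℕ.+ n)) (γ i 1 * β j (c ℕ.+ n)))
      where
      lemma : ∀ x y → x + y - y ≡ x
      lemma = solve-∀

    -- Turns equality of normalised coordinates into the column operation that leads from one edge
    -- to the other.
    shift-by : ∀ x x′ y y′ u u′ → x - u * y ≈ x′ - u′ * y′ → y ≈ y′ → x′ ≈ x - (u - u′) * y
    shift-by x x′ y y′ u u′ eq y≈ = ≈-trans (≈-reflexive (before x′ (u′ * y′)))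
      (≈-trans (+-cong (≈-sym eq) (*-cong (≈-refl {u′}) (≈-sym y≈))) (≈-reflexive (after x u u′ y)))
      where
      before : ∀ x y → x ≡ x - y + y
      before = solve-∀
      after : ∀ x u u′ y → x - u * y + u′ * y ≡ x - (u - u′) * y
      after = solve-∀

    unshift : ∀ x y u u′ → u ≈ u′ → x - (u - u′) * y ≈ x
    unshift x y u u′ u≈ = ≈-trans
      (-‿cong (≈-refl {x}) (*-cong (-‿cong u≈ (≈-refl {u′})) (≈-refl {y})))
      (≈-reflexive (lemma x y u′))
      where
      lemma : ∀ x y u → x - (u - u) * y ≡ x
      lemma = solve-∀

    module SamePoint {i j j′} (s≡ : s i j ≡ s i j′) where

      sˢ-same : sˢ i j ≈[ m₀ ℕ.+ c ] sˢ i j′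
      sˢ-same = pack-injective (sˢ i j) (sˢ i j′) s≡

      α⁺-same : ∀ {n} → n < d → α i j (suc (c ℕ.+ n)) ≈ α i j′ (suc (c ℕ.+ n))
      α⁺-same {n} n<d = ≈-trans (≈-reflexive (sym (sˢ-low i j n<d)))
        (≈-trans (sˢ-same (ℕ.<-≤-trans n<d (ℕ.≤-trans (ℕ.m≤m+n d h₀) (ℕ.≤-reflexive d+h₀≡m₀+c))))
                 (≈-reflexive (sˢ-low i j′ n<d)))

      -- The coefficients up to c are digits of the point label and the next d are part of `s`;
      -- `m≤c+d` makes these enough.
      α-same : α i j ≈[ suc m ] α i j′
      α-same {zero}  _ = ≈-refl
      α-same {suc n} (s≤s n<m) with <-or-+ c n
      ... | inj₁ n<c = ≈-reflexive (trans (α-low i j n<c) (sym (α-low i j′ n<c)))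
      ... | inj₂ (k , refl) = α⁺-same (ℕ.+-cancelˡ-< c k d (ℕ.<-≤-trans n<m m≤c+d))

      βᴾ-same : βᴾ i j ≈[ h ] βᴾ i j′
      βᴾ-same {zero}  _ = ≈-reflexive (trans (lemma (β j 0)) (sym (lemma (β j′ 0))))
        where
        lemma : ∀ x → x - x * 1ℤ ≡ 0ℤ
        lemma = solve-∀
      βᴾ-same {suc n} (s≤s n<h₀) = ≈-trans (≈-reflexive (sym (sˢ-high i j n)))
        (≈-trans (sˢ-same (ℕ.<-≤-trans (ℕ.+-monoʳ-< d n<h₀) (ℕ.≤-reflexive d+h₀≡m₀+c)))
                 (≈-reflexive (sˢ-high i j′ n)))

      α-same-h : α i j ≈[ h ] α i j′
      α-same-h n<h = α-same (ℕ.<-≤-trans n<h (s≤s h≤1+m))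

      -- The determinant equation can be solved for δᴾ, as α has constant coefficient 1.
      δᴾ-same : δᴾ i j ≈[ h ] δᴾ i j′
      δᴾ-same = conv-cancelˡ (α i j) (δᴾ i j) (δᴾ i j′) refl λ {n} n<h → ≈-trans (≈-reflexive (detᴾ i j n))
        (≈-trans (+-cong (≈-refl {one n}) (conv-cong (βᴾ i j) (βᴾ i j′) (γ i) (γ i) βᴾ-same (λ _ → ≈-refl) n<h))
        (≈-trans (≈-reflexive (sym (detᴾ i j′ n)))
          (conv-cong (α i j′) (α i j) (δᴾ i j′) (δᴾ i j′) (≈-sym ∘ α-same-h) (λ _ → ≈-refl) n<h)))

      β-shift : β j′ ≈[ h ] λ n → β j n - (β j 0 - β j′ 0) * α i j n
      β-shift {n} n<h = shift-by (β j n) (β j′ n) (α i j n) (α i j′ n) (β j 0) (β j′ 0) (βᴾ-same n<h) (α-same-h n<h)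

      δ-shift : δ i j′ ≈[ h ] λ n → δ i j n - (β j 0 - β j′ 0) * γ i n
      δ-shift {n} n<h = shift-by (δ i j n) (δ i j′ n) (γ i n) (γ i n) (β j 0) (β j′ 0) (δᴾ-same n<h) ≈-refl

      -- The column operation between two edges at a point has multiplier β(0) - β′(0). Contraposed:
      -- lines with different labels through a common point give a nonzero multiplier.
      line-determined : β j 0 ≈ β j′ 0 → j ≡ j′
      line-determined β₀≈ = digit-injective a same
        where
        β-same : ∀ n → β j n ≈ β j′ n
        β-same n with <-or-+ h n
        ... | inj₁ n<h = ≈-sym (≈-trans (β-shift n<h) (unshift (β j n) (α i j n) (β j 0) (β j′ 0) β₀≈))
        ... | inj₂ (k , refl) = ≈-reflexive (trans (β-high j k) (sym (β-high j′ k)))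
        same : digit a j ≈[ a ] digit a j′
        same {n} n<a with <-or-+ h n
        ... | inj₁ n<h = ≈-trans (≈-reflexive (sym (β-low j n<h)))
                           (≈-trans (β-same n) (≈-reflexive (β-low j′ n<h)))
        -- Digits from h on are coefficients of αᴸ, recovered from α and β, which agree already.
        ... | inj₂ (k , refl) = ≈-trans (≈-reflexive (sym (αᴸ-free i j k)))
          (≈-trans (-‿cong (α⁺-same k<d) (*-cong (≈-refl {γ i 1}) (β-same (c ℕ.+ k))))
                   (≈-reflexive (αᴸ-free i j′ k)))
          where
          k<d : k < d
          k<d = ℕ.+-cancelˡ-< h k d (ℕ.<-≤-trans n<a (ℕ.≤-reflexive (sym h+d≡m+c)))

    module SameLine {i i′ j} (t≡ : t i j ≡ t i′ j) where

      tˢ-same : tˢ i j ≈[ m₀ ℕ.+ c ] tˢ i′ j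
      tˢ-same = pack-injective (tˢ i j) (tˢ i′ j) t≡

      αᴸ-same : ∀ n → αᴸ i j n ≈ αᴸ i′ j n
      αᴸ-same zero = ≈-reflexive (trans (αᴸ₀ i j) (sym (αᴸ₀ i′ j)))
      αᴸ-same (suc n) with <-or-+ c n
      ... | inj₁ n<c = ≈-trans (≈-reflexive (sym (tˢ-low i j n<c)))
        (≈-trans (tˢ-same (ℕ.<-≤-trans n<c (ℕ.m≤n+m c m₀))) (≈-reflexive (tˢ-low i′ j n<c)))
      ... | inj₂ (k , refl) = ≈-reflexive (trans (αᴸ-free i j k) (sym (αᴸ-free i′ j k)))

      γᴸ-same : γᴸ i j ≈[ suc m ] γᴸ i′ j
      γᴸ-same {zero} _ = ≈-reflexive (trans (lemma (γ i 1)) (sym (lemma (γ i′ 1))))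
        where
        lemma : ∀ x → 0ℤ - x * 0ℤ ≡ 0ℤ
        lemma = solve-∀
      -- The normalisation at index 1 rests on δ(0) = 1, which follows from γ(0) = 0.
      γᴸ-same {suc zero} _ = ≈-reflexive (trans (lemma (γ i 1) (β j 0)) (sym (lemma (γ i′ 1) (β j 0))))
        where
        lemma : ∀ x y → x - x * (1ℤ + y * 0ℤ) ≡ 0ℤ
        lemma = solve-∀
      γᴸ-same {suc (suc n)} (s≤s (s≤s n<m₀)) = ≈-trans (≈-reflexive (sym (tˢ-high i j n)))
        (≈-trans (tˢ-same (ℕ.<-≤-trans (ℕ.+-monoʳ-< c n<m₀) (ℕ.≤-reflexive (ℕ.+-comm c m₀))))
                 (≈-reflexive (tˢ-high i′ j n)))

      δ-same : δ i j ≈[ suc m ] δ i′ j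
      δ-same = conv-cancelˡ (αᴸ i j) (δ i j) (δ i′ j) (αᴸ₀ i j) λ {n} n≤m →
        ≈-trans (≈-reflexive (detᴸ i j n))
        (≈-trans (+-cong (≈-refl {one n}) (conv-cong (β j) (β j) (γᴸ i j) (γᴸ i′ j) (λ _ → ≈-refl) γᴸ-same n≤m))
        (≈-trans (≈-reflexive (sym (detᴸ i′ j n)))
          (conv-cong (αᴸ i′ j) (αᴸ i j) (δ i′ j) (δ i′ j) (λ {k} _ → ≈-sym (αᴸ-same k)) (λ _ → ≈-refl) n≤m)))

      α-shift : ∀ n → α i′ j n ≈ α i j n - (γ i 1 - γ i′ 1) * (x· β j) n
      α-shift n = shift-by (α i j n) (α i′ j n) ((x· β j) n) ((x· β j) n) (γ i 1) (γ i′ 1) (αᴸ-same n) ≈-refl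

      γ-shift : γ i′ ≈[ suc m ] λ n → γ i n - (γ i 1 - γ i′ 1) * (x· δ i j) n
      γ-shift {n} n≤m = shift-by (γ i n) (γ i′ n) ((x· δ i j) n) ((x· δ i′ j) n) (γ i 1) (γ i′ 1) (γᴸ-same n≤m)
        (x·-cong (δ i j) (δ i′ j) (λ n<m → δ-same (ℕ.m≤n⇒m≤1+n n<m)) n≤m)

      point-determined : γ i 1 ≈ γ i′ 1 → i ≡ i′
      point-determined γ₁≈ = digit-injective a same
        where
        same : digit a i ≈[ a ] digit a i′
        same {n} n<a with <-or-+ m n
        ... | inj₁ n<m = ≈-sym (≈-trans (γ-shift (s≤s n<m))
                           (unshift (γ i (suc n)) (δ i j n) (γ i 1) (γ i′ 1) γ₁≈))
        ... | inj₂ (k , refl) = ≈-trans (≈-reflexive (sym (α-low i j k<c)))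
          (≈-trans (≈-sym (≈-trans (α-shift (suc k)) (unshift (α i j (suc k)) (β j k) (γ i 1) (γ i′ 1) γ₁≈)))
                   (≈-reflexive (α-low i′ j k<c)))
          where
          k<c : k < c
          k<c = ℕ.+-cancelˡ-< m k c n<a

  -- Degree growth in the continuant recurrence.

  module Degree (q m h : ℕ) (m≤h : m ≤ h) (h≤1+m : h ≤ suc m) where
    open SeriesCongruence q

    -- W k and Z k pair a fixed line with the k-th point and the k-th line of a walk.
    module Recurrence
      (noZeroDivisors : ∀ x y → x * y ≈ 0ℤ → x ≈ 0ℤ ⊎ y ≈ 0ℤ) (1≉0 : ¬ 1ℤ ≈ 0ℤ)
      (W Z : ℕ → Series) (a b : ℕ → ℤ)
      (Z-step : ∀ k → Z (suc k) ≈[ h ] λ n → Z k n - a k * W k n)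
      (W-step : ∀ k → W (suc k) ≈[ suc m ] λ n → W k n - b k * (x· Z (suc k)) n)
      (a≉0 : ∀ k → ¬ a k ≈ 0ℤ) (b≉0 : ∀ k → ¬ b k ≈ 0ℤ)
      (Z₀ : Z 0 ≈[ h ] λ _ → 0ℤ) (W₀ : W 0 ≈[ suc m ] one) where

      -‿vanish : ∀ {x} c {y} → x ≈ 0ℤ → y ≈ 0ℤ → x - c * y ≈ 0ℤ
      -‿vanish c x≈0 y≈0 = ≈-trans (-‿cong x≈0 (*-cong (≈-refl {c}) y≈0)) (≈-reflexive (lemma c))
        where
        lemma : ∀ c → 0ℤ - c * 0ℤ ≡ 0ℤ
        lemma = solve-∀

      -‿lead : ∀ {x c y} → x ≈ 0ℤ → ¬ c ≈ 0ℤ → ¬ y ≈ 0ℤ → ¬ x - c * y ≈ 0ℤ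
      -‿lead {x} {c} {y} x≈0 c≉0 y≉0 eq = [ c≉0 , y≉0 ]′ (noZeroDivisors c y
        (≈-trans (≈-reflexive (lemma x (c * y))) (-‿cong x≈0 eq)))
        where
        lemma : ∀ x z → z ≡ x - (x - z)
        lemma = solve-∀

      mutual
        -- Within the truncation `Z k` has degree below k and `W k` degree at most k: only the
        -- factor x in `W-step` raises the degree.
        Z-vanish : ∀ k {n} → k ≤ n → n < h → Z k n ≈ 0ℤ
        Z-vanish zero    _   n<h = Z₀ n<h
        Z-vanish (suc k) {n} k<n n<h = ≈-trans (Z-step k n<h)
          (-‿vanish (a k) (Z-vanish k (ℕ.<⇒≤ k<n) n<h) (W-vanish k k<n (ℕ.<-≤-trans n<h h≤1+m)))

        W-vanish : ∀ k {n} → k < n → n < suc m → W k n ≈ 0ℤ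
        W-vanish zero    {suc n} _ n≤m = W₀ n≤m
        W-vanish (suc k) {suc n} (s≤s k<n) n≤m = ≈-trans (W-step k n≤m)
          (-‿vanish (b k) (W-vanish k (ℕ.m≤n⇒m≤1+n k<n) n≤m) (Z-vanish (suc k) k<n (ℕ.<-≤-trans (ℕ.≤-pred n≤m) m≤h)))

      mutual
        -- The top coefficient is, up to sign, the product of all multipliers so far, hence nonzero
        -- modulo a prime.
        Z-lead : ∀ k → k < h → ¬ Z (suc k) k ≈ 0ℤ
        Z-lead k k<h eq = -‿lead (Z-vanish k ℕ.≤-refl k<h) (a≉0 k) (W-lead k (ℕ.<-≤-trans k<h h≤1+m))
          (≈-trans (≈-sym (Z-step k k<h)) eq)

        W-lead : ∀ k → k < suc m → ¬ W k k ≈ 0ℤ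
        W-lead zero    0≤m eq = 1≉0 (≈-trans (≈-sym (W₀ 0≤m)) eq)
        W-lead (suc k) k≤m eq = -‿lead (W-vanish k (ℕ.n<1+n k) k≤m) (b≉0 k) (Z-lead k (ℕ.<-≤-trans (ℕ.≤-pred k≤m) m≤h))
          (≈-trans (≈-sym (W-step k k≤m)) eq)

  -- Determinants along walks.

  module Pairings (q : ℕ) .{{_ : NonZero q}} {ℓ} (P : Parameters ℓ) (q-prime : Prime q) where

    open Parameters P
    open Coordinates q P public
    open Walks s t

    module Pairing (β* δ* : Series) where

      -- The determinant of the columns (f, g) and (β*, δ*).
      Φ : Series → Series → Series
      Φ f g n = conv f δ* n - conv β* g n

      Φ-cong : ∀ {N} f f′ g g′ → f ≈[ N ] f′ → g ≈[ N ] g′ → Φ f g ≈[ N ] Φ f′ g′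
      Φ-cong f f′ g g′ f≈ g≈ n<N = -‿cong
        (conv-cong f f′ δ* δ* f≈ (λ _ → ≈-refl) n<N) (conv-cong β* β* g g′ (λ _ → ≈-refl) g≈ n<N)

      Φ-minus : ∀ f g f′ g′ c n → Φ (λ k → f k - c * f′ k) (λ k → g k - c * g′ k) n ≡ Φ f g n - c * Φ f′ g′ n
      Φ-minus f g f′ g′ c n = trans
        (cong₂ _-_ (conv-minusˡ f δ* f′ c n) (conv-minusʳ β* g g′ c n))
        (lemma (conv f δ* n) (conv f′ δ* n) (conv β* g n) (conv β* g′ n) c)
        where
        lemma : ∀ u v w z c → (u - c * v) - (w - c * z) ≡ (u - w) - c * (v - z)
        lemma = solve-∀

      Φ-x : ∀ f g n → Φ (x· f) (x· g) n ≡ (x· Φ f g) n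
      Φ-x f g n = trans (cong₂ _-_ (conv-xˡ f δ* n) (conv-xʳ β* g n)) (lemma n)
        where
        lemma : ∀ n → (x· conv f δ*) n - (x· conv β* g) n ≡ (x· Φ f g) n
        lemma zero    = refl
        lemma (suc n) = refl

      Φᴾ Φᴸ : Label → Label → Series
      Φᴾ i j = Φ (α i j) (γ i)
      Φᴸ i j = Φ (β j) (δ i j)

      Φᴾ-same : ∀ {i j j′} → s i j ≡ s i j′ → Φᴾ i j ≈[ suc m ] Φᴾ i j′
      Φᴾ-same {i} {j} {j′} s≡ = Φ-cong (α i j) (α i j′) (γ i) (γ i) (SamePoint.α-same s≡) (λ _ → ≈-refl)

      Φᴸ-same : ∀ {i i′ j} → t i j ≡ t i′ j → Φᴸ i j ≈[ suc m ] Φᴸ i′ j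
      Φᴸ-same {i} {i′} {j} t≡ = Φ-cong (β j) (β j) (δ i j) (δ i′ j) (λ _ → ≈-refl) (SameLine.δ-same t≡)

      Φᴸ-shift : ∀ {i j j′} → s i j ≡ s i j′ → Φᴸ i j′ ≈[ h ] λ n → Φᴸ i j n - (β j 0 - β j′ 0) * Φᴾ i j n
      Φᴸ-shift {i} {j} {j′} s≡ {n} n<h = ≈-trans
        (Φ-cong (β j′) _ (δ i j′) _ (SamePoint.β-shift s≡) (SamePoint.δ-shift s≡) n<h)
        (≈-reflexive (Φ-minus (β j) (δ i j) (α i j) (γ i) (β j 0 - β j′ 0) n))

      Φᴾ-shift : ∀ {i i′ j} → t i j ≡ t i′ j → Φᴾ i′ j ≈[ suc m ] λ n → Φᴾ i j n - (γ i 1 - γ i′ 1) * (x· Φᴸ i j) n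
      Φᴾ-shift {i} {i′} {j} t≡ {n} n≤m = ≈-trans
        (Φ-cong (α i′ j) _ (γ i′) _ (λ {k} _ → SameLine.α-shift t≡ k) (SameLine.γ-shift t≡) n≤m)
        (≈-reflexive (trans (Φ-minus (α i j) (γ i) (x· β j) (x· δ i j) b n)
                            (cong (λ z → Φᴾ i j n - b * z) (Φ-x (β j) (δ i j) n))))
        where b = γ i 1 - γ i′ 1

    -- The reference column comes from any edge at the first line, not necessarily an edge of the
    -- walk, so that two walks can be paired with the same column.
    module FromBase (i₀ : Label) (w : Walk) (base : t i₀ (Walk.line w 0) ≡ t (Walk.point w 0) (Walk.line w 0)) where
      open Walk w
      j₀ = line 0
      open Pairing (β j₀) (δ i₀ j₀) public

      W Z : ℕ → Series
      W k = Φᴾ (point k) (line k)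
      Z k = Φᴸ (point k) (line k)

      a′ b′ : ℕ → ℤ
      a′ k = β (line k) 0 - β (line (suc k)) 0
      b′ k = γ (point k) 1 - γ (point (suc k)) 1

      difference⇒≈ : ∀ {x y} → x - y ≈ 0ℤ → x ≈ y
      difference⇒≈ {x} {y} eq = ≈-trans (≈-reflexive (lemma x y))
        (≈-trans (+-cong eq (≈-refl {y})) (≈-reflexive (ℤ.+-identityˡ y)))
        where
        lemma : ∀ x y → x ≡ x - y + y
        lemma = solve-∀

      Z-step : ∀ k → Z (suc k) ≈[ h ] λ n → Z k n - a′ k * W k n
      Z-step k n<h = ≈-trans (Φᴸ-same (sym (at-line k)) (ℕ.<-≤-trans n<h (s≤s h≤1+m))) (Φᴸ-shift (at-point k) n<h)

      W-step : ∀ k → W (suc k) ≈[ suc m ] λ n → W k n - b′ k * (x· Z (suc k)) n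
      W-step k {n} n≤m = ≈-trans (Φᴾ-shift (at-line k) n≤m)
        (-‿cong (Φᴾ-same (sym (at-point k)) n≤m)
          (*-cong (≈-refl {b′ k}) (x·-cong (Φᴸ (point k) (line (suc k))) (Z (suc k))
            (λ n<m → Φᴸ-same (at-line k) (ℕ.m≤n⇒m≤1+n n<m)) n≤m)))

      -- The first line is paired with its own column, and a determinant with a repeated column is
      -- 0.
      Z₀ : Z 0 ≈[ suc m ] λ _ → 0ℤ
      Z₀ {n} n≤m = ≈-trans (Φᴸ-same (sym base) n≤m) (≈-reflexive (ℤ.+-inverseʳ (conv (β j₀) (δ i₀ j₀) n)))

      -- The first point and the first line span an edge, whose matrix has determinant 1.
      W₀ : W 0 ≈[ suc m ] one
      W₀ {n} n≤m = ≈-trans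
        (-‿cong (conv-cong (α p j₀) (α p j₀) (δ i₀ j₀) (δ p j₀) (λ _ → ≈-refl) (SameLine.δ-same base) n≤m)
          (≈-refl {conv (β j₀) (γ p) n}))
        (≈-reflexive (trans (cong (_- conv (β j₀) (γ p) n) (det p j₀ n)) (lemma (one n) (conv (β j₀) (γ p) n))))
        where
        p = point 0
        lemma : ∀ x y → x + y - y ≡ x
        lemma = solve-∀

      a≉0 : ∀ k → ¬ a′ k ≈ 0ℤ
      a≉0 k eq = lines-differ k (SamePoint.line-determined (at-point k) (difference⇒≈ eq))

      b≉0 : ∀ k → ¬ b′ k ≈ 0ℤ
      b≉0 k eq = points-differ k (SameLine.point-determined (at-line k) (difference⇒≈ eq))

      Z₀-h : Z 0 ≈[ h ] λ _ → 0ℤ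
      Z₀-h n<h = Z₀ (ℕ.<-≤-trans n<h (s≤s h≤1+m))

      module Deg = Degree q m h (s≤s m≤h) (s≤s h≤1+m)
      open Deg.Recurrence (prime⇒noZeroDivisors q-prime) (prime⇒1≉0 q-prime)
        W Z a′ b′ Z-step W-step a≉0 b≉0 Z₀-h W₀ public

    module TwoWalks (F G : Walk) (start : SameStart F G) where

      private
        module F = Walk F
        module G = Walk G
        j-start = proj₁ start
        t-start = proj₂ start
        module F* = FromBase (F.point 0) F refl
        module G* = FromBase (F.point 0) G (subst (λ j → t (F.point 0) j ≡ t (G.point 0) (G.line 0)) (sym j-start) t-start)

      open Pairing (β (F.line 0)) (δ (F.point 0) (F.line 0))

      G*W : ∀ k n → G*.W k n ≡ Φᴾ (G.point k) (G.line k) n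
      G*W k n = cong (λ j → Pairing.Φᴾ (β j) (δ (F.point 0) j) (G.point k) (G.line k) n) j-start

      G*Z : ∀ k n → G*.Z k n ≡ Φᴸ (G.point k) (G.line k) n
      G*Z k n = cong (λ j → Pairing.Φᴸ (β j) (δ (F.point 0) j) (G.point k) (G.line k) n) j-start

      -- The coefficient of x^m separates the ends: F has only reached degree m - 1, while G has
      -- just reached degree m.
      points-never-meet : ¬ MeetAtPoint F G m₀ m
      points-never-meet (i-end , s-end) = G*.W-lead m ℕ.≤-refl (begin
        G*.W m m                     ≡⟨ G*W m m ⟩
        Φᴾ (G.point m) (G.line m) m  ≡⟨ cong (λ i → Φᴾ i (G.line m) m) i-end ⟩
        Φᴾ (F.point m₀) (G.line m) m ≈⟨ Φᴾ-same (trans s-end (cong (λ i → s i (G.line m)) i-end)) ℕ.≤-refl ⟨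
        F*.W m₀ m                    ≈⟨ F*.W-vanish m₀ ℕ.≤-refl ℕ.≤-refl ⟩
        0ℤ                           ∎)
        where open SetoidReasoning setoid

      -- Again the coefficient of x^m decides: it vanishes in `Z m` and leads in `Z (suc m)`. It
      -- survives the truncation since m < h.
      lines-never-meet : m < h → ¬ MeetAtLine F G m (suc m)
      lines-never-meet m<h (j-end , t-end) = G*.Z-lead m m<h (begin
        G*.Z (suc m) m                           ≡⟨ G*Z (suc m) m ⟩
        Φᴸ (G.point (suc m)) (G.line (suc m)) m  ≡⟨ cong (λ j → Φᴸ (G.point (suc m)) j m) j-end ⟩
        Φᴸ (G.point (suc m)) (F.line m) m        ≈⟨ Φᴸ-same (trans t-end (cong (t (G.point (suc m))) j-end)) ℕ.≤-refl ⟨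
        F*.Z m m                                 ≈⟨ F*.Z-vanish m ℕ.≤-refl m<h ⟩
        0ℤ                                       ∎)
        where open SetoidReasoning setoid

-- Sizes of the parts.

open import Data.List using (List; length; lookup; filter; _∷_; [])
open import Data.List.Membership.Propositional.Properties using (∈-lookup)
open import Data.List.Relation.Unary.All as All using (_∷_)
import Data.List.Relation.Unary.All.Properties as All
open import Data.List.Relation.Unary.AllPairs using (_∷_)
open import Data.List.Relation.Unary.Unique.Propositional using (Unique)
import Data.List.Relation.Unary.Unique.Propositional.Properties as Unique
open import Data.Nat using (_*_; _+_; _∸_; _^_; _!)
open import Data.Nat.DivMod using (_%_; _/_; _mod_; m%n<n; m<n⇒m%n≡m; m≡m%n+[m/n]*n; [m+kn]%n≡m%n; n%n≡0)
open import Data.Nat.ListAction using (product)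
open import Data.Nat.Logarithm using (⌊log₂_⌋; ⌊log₂⌋-mono-≤)
open import Data.Nat.Primality.Factorisation using (factorise)
open import Data.Nat.Tactic.RingSolver using (solve-∀)

open PowerSeries using (module Pairings)

lookup-injective : ∀ {A : Set} {xs : List A} → Unique xs → Injective _≡_ _≡_ (lookup xs)
lookup-injective (_ ∷ _)    {Fin.zero}  {Fin.zero}  _  = refl
lookup-injective (x≢ ∷ _)   {Fin.zero}  {Fin.suc l} eq = contradiction eq (All.lookup x≢ (∈-lookup l))
lookup-injective (x≢ ∷ _)   {Fin.suc k} {Fin.zero}  eq = contradiction (sym eq) (All.lookup x≢ (∈-lookup k))
lookup-injective (_ ∷ uniq) {Fin.suc k} {Fin.suc l} eq = cong Fin.suc (lookup-injective uniq eq)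

quotient-combine : ∀ {r k} (i : Fin r) (ρ : Fin k) → quotient k (combine i ρ) ≡ i
quotient-combine i ρ = cong proj₁ (Fin.remQuot-combine i ρ)

-- Vertices of one part are told apart by their remainders, so the part injects into `Fin k`.
partSize-quotient : ∀ r k (i : Fin r) → partSize {r * k} (quotient k) i ≤ k
partSize-quotient r k i = Fin.injective⇒≤ {f = remainder {r} k ∘ lookup part} λ {x} {y} eq →
  lookup-injective unique (begin
    lookup part x                          ≡⟨ Fin.combine-remQuot {r} k _ ⟨
    combine (quotient {r} k (lookup part x)) (remainder {r} k (lookup part x))
      ≡⟨ cong₂ combine (trans (in-part x) (sym (in-part y))) eq ⟩
    combine (quotient {r} k (lookup part y)) (remainder {r} k (lookup part y))
      ≡⟨ Fin.combine-remQuot {r} k _ ⟩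
    lookup part y ∎)
  where
  open ≡-Reasoning
  part = filter (λ v → quotient {r} k v Fin.≟ i) (Defs.allFin (r * k))
  unique : Unique part
  unique = Unique.filter⁺ _ (Unique.tabulate⁺ id)
  in-part : ∀ x → quotient {r} k (lookup part x) ≡ i
  in-part x = All.lookup (All.all-filter _ (Defs.allFin (r * k))) (∈-lookup x)

suc-% : ∀ k n .{{_ : NonZero n}} → suc k % n ≡ suc (k % n) % n
suc-% k n = trans (cong (λ x → suc x % n) (m≡m%n+[m/n]*n k n)) ([m+kn]%n≡m%n (suc (k % n)) (k / n) n)

-- Cycles unrolled to periodic sequences.

module Cyclic {n M} (G : Graph n) (cycle : ContainsCycle G (suc M)) (2≤M : 2 ≤ M) where

  private
    P = suc M
    c = proj₁ cycle

  index : ℕ → Fin P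
  index k = k mod P

  toℕ-index : ∀ k → toℕ (index k) ≡ k % P
  toℕ-index k = Fin.toℕ-fromℕ< (m%n<n k P)

  vertex : ℕ → Fin n
  vertex k = c (index k)

  last-or-inner : ∀ k → (k % P ≡ M × suc k % P ≡ 0) ⊎ (k % P < M × suc k % P ≡ suc (k % P))
  last-or-inner k with k % P ℕ.≟ M
  ... | yes eq = inj₁ (eq , trans (suc-% k P) (trans (cong (λ x → suc x % P) eq) (n%n≡0 P)))
  ... | no  neq = inj₂ (k%P<M , trans (suc-% k P) (m<n⇒m%n≡m (s≤s k%P<M)))
    where
    k%P<M : k % P < M
    k%P<M = ℕ.≤∧≢⇒< (ℕ.≤-pred (m%n<n k P)) neq

  adjacent : ∀ k → Adj G (vertex k) (vertex (suc k))
  adjacent k with last-or-inner k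
  ... | inj₁ (last , wraps) = subst₂ (λ x y → Adj G (c x) (c y))
    (Fin.toℕ-injective (trans (Fin.toℕ-fromℕ M) (sym (trans (toℕ-index k) last))))
    (Fin.toℕ-injective (sym (trans (toℕ-index (suc k)) wraps)))
    (proj₂ (proj₂ (proj₂ cycle)))
  ... | inj₂ (k<M , steps) = subst₂ (λ x y → Adj G (c x) (c y))
    (Fin.toℕ-injective (trans (Fin.toℕ-inject₁ _) (trans (Fin.toℕ-fromℕ< k<M) (sym (toℕ-index k)))))
    (Fin.toℕ-injective (trans (cong suc (Fin.toℕ-fromℕ< k<M)) (sym (trans (toℕ-index (suc k)) steps))))
    (proj₁ (proj₂ (proj₂ cycle)) (fromℕ< k<M))

  -- The length P is at least 3, so two steps never close up, wherever the wrap-around falls.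
  two-apart-% : ∀ k → k % P ≢ suc (suc k) % P
  two-apart-% k eq with last-or-inner k | last-or-inner (suc k)
  ... | inj₁ (l , w) | inj₁ (l′ , w′) =
    contradiction (subst (2 ≤_) (trans (sym l′) w) 2≤M) λ ()
  ... | inj₁ (l , w) | inj₂ (l′ , w′) =
    contradiction (subst (2 ≤_) (trans (sym l) (trans eq (trans w′ (cong suc w)))) 2≤M) λ { (s≤s ()) }
  ... | inj₂ (l , w) | inj₁ (l′ , w′) =
    contradiction (subst (2 ≤_) (trans (sym l′) (trans w (cong suc (trans eq w′)))) 2≤M) λ { (s≤s ()) }
  ... | inj₂ (l , w) | inj₂ (l′ , w′) = ℕ.<⇒≢ (ℕ.m≤n⇒m≤1+n ℕ.≤-refl) (trans eq (trans w′ (cong suc w)))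

  two-apart : ∀ k → vertex k ≢ vertex (suc (suc k))
  two-apart k eq = two-apart-% k (trans (sym (toℕ-index k))
    (trans (cong toℕ (proj₁ (proj₂ cycle) eq)) (toℕ-index (suc (suc k)))))

  periodic : ∀ k x → vertex (k + x * P) ≡ vertex k
  periodic k x = cong c (Fin.toℕ-injective (trans (toℕ-index (k + x * P)) (trans ([m+kn]%n≡m%n k x P) (sym (toℕ-index k)))))

-- The point-line incidence graph.

module IncidenceGraph {r S : ℕ} (s t : Fin r → Fin r → Fin S) where

  open Walks s t

  private
    K = 2 * S

  -- A part holds the points and the lines with one label; the factor 2 in `K` tells the two kinds
  -- apart.
  point line : Fin r → Fin S → Fin (r * K)
  point i ρ = combine i (combine {2} Fin.zero ρ)
  line  j ρ = combine j (combine {2} (Fin.suc Fin.zero) ρ)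

  -- Each pair of labels contributes one edge, which is why any two parts are joined.
  Edge : Fin (r * K) → Fin (r * K) → Set
  Edge u v = ∃[ i ] ∃[ j ] (u ≡ point i (s i j) × v ≡ line j (t i j))

  point-injective : ∀ {i ρ i′ ρ′} → point i ρ ≡ point i′ ρ′ → i ≡ i′ × ρ ≡ ρ′
  point-injective {i} {ρ} {i′} {ρ′} eq =
    proj₁ (Fin.combine-injective i _ i′ _ eq) ,
    proj₂ (Fin.combine-injective {2} Fin.zero ρ Fin.zero ρ′ (proj₂ (Fin.combine-injective i _ i′ _ eq)))

  line-injective : ∀ {j ρ j′ ρ′} → line j ρ ≡ line j′ ρ′ → j ≡ j′ × ρ ≡ ρ′
  line-injective {j} {ρ} {j′} {ρ′} eq =
    proj₁ (Fin.combine-injective j _ j′ _ eq) ,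
    proj₂ (Fin.combine-injective {2} (Fin.suc Fin.zero) ρ (Fin.suc Fin.zero) ρ′ (proj₂ (Fin.combine-injective j _ j′ _ eq)))

  point≢line : ∀ {i ρ j ρ′} → point i ρ ≢ line j ρ′
  point≢line {i} {ρ} {j} {ρ′} eq
    with () ← proj₁ (Fin.combine-injective {2} Fin.zero ρ (Fin.suc Fin.zero) ρ′ (proj₂ (Fin.combine-injective i _ j _ eq)))

  graph : Graph (r * K)
  graph = record
    { Adj    = λ u v → Edge u v ⊎ Edge v u
    ; sym    = swap
    ; irrefl = λ { (inj₁ (_ , _ , p , l)) → point≢line (trans (sym p) l)
                 ; (inj₂ (_ , _ , p , l)) → point≢line (trans (sym p) l) } }

  isRKPartition : IsRKPartition graph r K (quotient K)
  isRKPartition = partSize-quotient r K , λ i j _ →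
    point i (s i j) , line j (t i j) , inj₁ (i , j , refl , refl) , quotient-combine i _ , quotient-combine j _

  record Path : Set where
    field
      vertex      : ℕ → Fin (r * K)
      adjacent    : ∀ k → Adj graph (vertex k) (vertex (suc k))
      two-apart   : ∀ k → vertex k ≢ vertex (suc (suc k))

  IsLine : Fin (r * K) → Set
  IsLine v = ∃[ j ] ∃[ ρ ] v ≡ line j ρ

  IsPoint : Fin (r * K) → Set
  IsPoint v = ∃[ i ] ∃[ ρ ] v ≡ point i ρ

  line→point : ∀ {u v} → IsLine u → Adj graph u v → Edge v u
  line→point (_ , _ , u≡) (inj₁ (_ , _ , u≡′ , _)) = contradiction (trans (sym u≡′) u≡) point≢line
  line→point _            (inj₂ e)                 = e

  point→line : ∀ {u v} → IsPoint u → Adj graph u v → Edge u v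
  point→line (_ , _ , u≡) (inj₂ (_ , _ , _ , u≡′)) = contradiction (trans (sym u≡) u≡′) point≢line
  point→line _            (inj₁ e)                 = e

  module Alternating (p : Path) (starts : IsLine (Path.vertex p 0)) where
    open Path p

    even-line : ∀ k → IsLine (vertex (k * 2))
    odd-point : ∀ k → IsPoint (vertex (suc (k * 2)))
    even-line zero    = starts
    even-line (suc k) with _ , j , _ , l≡ ← point→line (odd-point k) (adjacent (suc (k * 2))) = j , _ , l≡
    odd-point k with i , _ , p≡ , _ ← line→point (even-line k) (adjacent (k * 2)) = i , _ , p≡

    lineAt pointAt : ℕ → Fin r
    lineAt  k = quotient K (vertex (k * 2))
    pointAt k = quotient K (vertex (suc (k * 2)))

    edge-labels : ∀ {u v} → Edge u v →
      u ≡ point (quotient K u) (s (quotient K u) (quotient K v)) ×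
      v ≡ line (quotient K v) (t (quotient K u) (quotient K v))
    edge-labels (i , j , refl , refl) =
      cong₂ (λ i′ j′ → point i′ (s i′ j′)) i≡ j≡ , cong₂ (λ i′ j′ → line j′ (t i′ j′)) i≡ j≡
      where
      i≡ = sym (quotient-combine i _)
      j≡ = sym (quotient-combine j _)

    edge : ∀ k → vertex (suc (k * 2)) ≡ point (pointAt k) (s (pointAt k) (lineAt k)) ×
                 vertex (k * 2) ≡ line (lineAt k) (t (pointAt k) (lineAt k))
    edge k = edge-labels (line→point (even-line k) (adjacent (k * 2)))

    next-edge : ∀ k → vertex (suc (k * 2)) ≡ point (pointAt k) (s (pointAt k) (lineAt (suc k))) ×
                      vertex (suc k * 2) ≡ line (lineAt (suc k)) (t (pointAt k) (lineAt (suc k)))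
    next-edge k = edge-labels (point→line (odd-point k) (adjacent (suc (k * 2))))

    at-point : ∀ k → s (pointAt k) (lineAt k) ≡ s (pointAt k) (lineAt (suc k))
    at-point k = proj₂ (point-injective (trans (sym (proj₁ (edge k))) (proj₁ (next-edge k))))

    at-line : ∀ k → t (pointAt k) (lineAt (suc k)) ≡ t (pointAt (suc k)) (lineAt (suc k))
    at-line k = proj₂ (line-injective (trans (sym (proj₂ (next-edge k))) (proj₂ (edge (suc k)))))

    -- With equal labels the two edges at the point would also have equal `t`, so both lines would
    -- be one vertex and the path would backtrack.
    lines-differ : ∀ k → lineAt k ≢ lineAt (suc k)
    lines-differ k eq = two-apart (k * 2) (trans (proj₂ (edge k))
      (trans (cong (λ j → line j (t (pointAt k) j)) eq) (sym (proj₂ (next-edge k)))))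

    points-differ : ∀ k → pointAt k ≢ pointAt (suc k)
    points-differ k eq = two-apart (suc (k * 2)) (trans (proj₁ (next-edge k))
      (trans (cong (λ i → point i (s i (lineAt (suc k)))) eq) (sym (proj₁ (edge (suc k))))))

  -- On a closed path of length M + 2, a step back is M + 1 steps forward; this avoids subtraction.
  reverse : (p : Path) → let open Path p in ∀ M → (∀ k → vertex (suc (suc M) + k) ≡ vertex k) → Path
  reverse p M wrap = record
    { vertex    = λ n → vertex (n * suc M)
    ; adjacent  = λ n → swap (subst (Adj graph (vertex (suc M + n * suc M))) (wrap (n * suc M))
                                    (adjacent (suc M + n * suc M)))
    -- Modulo the length, M + n (M + 1) is the position n + 2 steps back, and two more steps lead to
    -- the position n steps back.
    ; two-apart = λ n eq → two-apart (M + n * suc M) (begin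
        vertex (M + n * suc M)                 ≡⟨ wrap _ ⟨
        vertex (suc (suc M) + (M + n * suc M)) ≡⟨ cong vertex (cong suc (shuffle M (n * suc M))) ⟩
        vertex (suc M + (suc M + n * suc M))   ≡⟨ eq ⟨
        vertex (n * suc M)                     ≡⟨ wrap _ ⟨
        vertex (suc (suc M) + n * suc M)       ∎) }
    where
    open Path p
    open ≡-Reasoning
    shuffle : ∀ M x → suc M + (M + x) ≡ M + (suc M + x)
    shuffle = solve-∀

  walk : (p : Path) → IsLine (Path.vertex p 0) → Walk
  walk p starts = record
    { line = lineAt ; point = pointAt ; at-point = at-point ; at-line = at-line
    ; lines-differ = lines-differ ; points-differ = points-differ }
    where open Alternating p starts

  module _ (p q : Path) (p₀ : IsLine (Path.vertex p 0)) (q₀ : IsLine (Path.vertex q 0))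
    (start : Path.vertex q 0 ≡ Path.vertex p 0) where

    private
      module p  = Path p
      module q  = Path q
      module p* = Alternating p p₀
      module q* = Alternating q q₀

    sameStart : SameStart (walk p p₀) (walk q q₀)
    sameStart = cong (quotient K) start ,
      proj₂ (line-injective (trans (sym (proj₂ (p*.edge 0))) (trans (sym start) (proj₂ (q*.edge 0)))))

    meetAtPoint : ∀ k l → q.vertex (suc (l * 2)) ≡ p.vertex (suc (k * 2)) → MeetAtPoint (walk p p₀) (walk q q₀) k l
    meetAtPoint k l end = cong (quotient K) end ,
      proj₂ (point-injective (trans (sym (proj₁ (p*.edge k))) (trans (sym end) (proj₁ (q*.edge l)))))

    meetAtLine : ∀ k l → q.vertex (l * 2) ≡ p.vertex (k * 2) → MeetAtLine (walk p p₀) (walk q q₀) k l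
    meetAtLine k l end = cong (quotient K) end ,
      proj₂ (line-injective (trans (sym (proj₂ (p*.edge k))) (trans (sym end) (proj₂ (q*.edge l)))))

  module _ (l₀ : ℕ) (0<l₀ : 0 < l₀) (cycle : ContainsCycle graph (2 * suc l₀)) where

    private
      l = suc l₀
      M = l₀ + (l₀ + 0)

      l+l : l₀ + suc (l₀ + 0) ≡ suc M
      l+l = ℕ.+-suc l₀ (l₀ + 0)

      cycle′ : ContainsCycle graph (suc (suc M))
      cycle′ = subst (λ x → ContainsCycle graph (suc x)) l+l cycle

      module C = Cyclic graph cycle′ (s≤s (ℕ.≤-trans 0<l₀ (ℕ.m≤m+n l₀ _)))

      from : ℕ → Path
      from b = record
        { vertex    = λ k → C.vertex (b + k)
        ; adjacent  = λ k → subst (λ x → Adj graph (C.vertex (b + k)) (C.vertex x))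
            (sym (ℕ.+-suc b k)) (C.adjacent (b + k))
        ; two-apart = λ k → subst (λ x → C.vertex (b + k) ≢ C.vertex x)
            (sym (trans (ℕ.+-suc b (suc k)) (cong suc (ℕ.+-suc b k)))) (C.two-apart (b + k)) }

      periodic : ∀ b k x → C.vertex (b + (k + x * suc (suc M))) ≡ C.vertex (b + k)
      periodic b k x = trans (cong C.vertex (sym (ℕ.+-assoc b k _))) (C.periodic (b + k) x)

      wrap : ∀ b k → C.vertex (b + (suc (suc M) + k)) ≡ C.vertex (b + k)
      wrap b k = trans (cong (λ x → C.vertex (b + x)) 
        (trans (ℕ.+-comm (suc (suc M)) k) (cong (k +_) (sym (ℕ.*-identityˡ (suc (suc M)))))))
        (periodic b k 1)

      -- On a cycle of length 2l, going l + 1 steps back and l - 1 steps forward ends at the same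
      -- vertex: (l + 1)(2l - 1) = (l - 1) + l * 2l.
      halfway : ∀ b → C.vertex (b + suc l * suc M) ≡ C.vertex (b + l₀)
      halfway b = trans (cong (λ x → C.vertex (b + x)) (arith l₀)) (periodic b l₀ l)
        where
        arith : ∀ l₀ → suc (suc l₀) * suc (l₀ + (l₀ + 0)) ≡ l₀ + suc l₀ * suc (suc (l₀ + (l₀ + 0)))
        arith = solve-∀

      line-start : ∃[ b ] IsLine (C.vertex (b + 0))
      line-start with C.adjacent 0
      ... | inj₁ (_ , j , _ , l≡) = 1 , j , _ , l≡
      ... | inj₂ (_ , j , _ , l≡) = 0 , j , _ , l≡

    paths-meet : ∃[ p ] ∃[ q ] (IsLine (Path.vertex p 0) ×
      Path.vertex q 0 ≡ Path.vertex p 0 × Path.vertex q (suc l) ≡ Path.vertex p l₀)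
    paths-meet = let b , starts = line-start in
      from b , reverse (from b) M (wrap b) , starts , refl , halfway b

  -- Half the length is even, so an odd number of steps leads from the starting line to the meeting
  -- vertex, a point. In the odd case below it is a line.
  even-cycleFree : ∀ m → (∀ F G → SameStart F G → ¬ MeetAtPoint F G m (suc m)) →
                   CycleFree graph (2 * (suc m * 2))
  even-cycleFree m never cycle =
    let p , q , p₀ , start , end = paths-meet (suc (m * 2)) (s≤s z≤n) cycle
        q₀ = subst IsLine (sym start) p₀
    in never (walk p p₀) (walk q q₀) (sameStart p q p₀ q₀ start) (meetAtPoint p q p₀ q₀ start m (suc m) end)

  odd-cycleFree : ∀ m → (∀ F G → SameStart F G → ¬ MeetAtLine F G (suc m) (suc (suc m))) →
                  CycleFree graph (2 * suc (suc m * 2))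
  odd-cycleFree m never cycle =
    let p , q , p₀ , start , end = paths-meet (suc m * 2) (s≤s z≤n) cycle
        q₀ = subst IsLine (sym start) p₀
    in never (walk p p₀) (walk q q₀) (sameStart p q p₀ q₀ start) (meetAtLine p q p₀ q₀ start (suc m) (suc (suc m)) end)

-- Choice of the parameters.

-- Raising ℓ by 4 adds 2 to m and h and 1 to c and d, hence 12 to both sides of `size`. In every
-- case m + c is the largest integer that `size` allows.
parameters : ∀ l → Parameters (suc (suc l))
parameters 0 = record { m₀ = 0 ; h₀ = 0 ; c = 1 ; d = 1 ; h+d≡m+c = refl
                      ; m≤c+d = s≤s z≤n ; m≤h = z≤n ; h≤1+m = z≤n
                      ; halves = inj₁ refl ; size = ℕ.m≤m+n 8 0 }
parameters 1 = record { m₀ = 0 ; h₀ = 1 ; c = 1 ; d = 0 ; h+d≡m+c = refl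
                      ; m≤c+d = s≤s z≤n ; m≤h = z≤n ; h≤1+m = s≤s z≤n
                      ; halves = inj₂ (s≤s (s≤s z≤n) , refl) ; size = ℕ.m≤m+n 8 3 }
parameters 2 = record { m₀ = 1 ; h₀ = 1 ; c = 1 ; d = 1 ; h+d≡m+c = refl
                      ; m≤c+d = s≤s (s≤s z≤n) ; m≤h = s≤s z≤n ; h≤1+m = s≤s z≤n
                      ; halves = inj₁ refl ; size = ℕ.m≤m+n 12 2 }
parameters 3 = record { m₀ = 1 ; h₀ = 2 ; c = 2 ; d = 1 ; h+d≡m+c = refl
                      ; m≤c+d = s≤s (s≤s z≤n) ; m≤h = s≤s z≤n ; h≤1+m = s≤s (s≤s z≤n)
                      ; halves = inj₂ (s≤s (s≤s (s≤s z≤n)) , refl) ; size = ℕ.m≤m+n 16 1 }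
parameters (suc (suc (suc (suc l)))) = record
  { m₀ = suc (suc m₀) ; h₀ = suc (suc h₀) ; c = suc c ; d = suc d
  ; h+d≡m+c = cong (suc ∘ suc) (trans (ℕ.+-suc h d) (trans (cong suc h+d≡m+c) (sym (ℕ.+-suc m c))))
  ; m≤c+d   = ℕ.≤-trans (s≤s (s≤s m≤c+d)) (ℕ.≤-reflexive (cong suc (sym (ℕ.+-suc c d))))
  ; m≤h     = s≤s (s≤s m≤h)
  ; h≤1+m   = s≤s (s≤s h≤1+m)
  ; halves  = Sum.map (cong (4 +_)) (λ (m<h , eq) → s≤s (s≤s m<h) , cong (4 +_) eq) halves
  ; size    = subst₂ _≤_ (left m₀ c) (right (2 + l)) (ℕ.+-monoʳ-≤ 12 size) }
  where
  open Parameters (parameters l)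
  left : ∀ m c → 12 + 4 * suc (m + c) ≡ 4 * suc (suc (suc m) + suc c)
  left = solve-∀
  right : ∀ l → 12 + (3 * l + 2) ≡ 3 * (4 + l) + 2
  right = solve-∀

-- Arbitrarily large primes.

prime-divisor : ∀ n → 2 ≤ n → ∃[ q ] (Prime q × q ℕ.∣ n)
prime-divisor n@(suc _) 2≤n with factorise n
... | record { factors = [] ; isFactorisation = eq } = contradiction (subst (2 ≤_) eq 2≤n) λ { (s≤s ()) }
... | record { factors = q ∷ qs ; isFactorisation = eq ; factorsPrime = q-prime ∷ _ } =
  q , q-prime , subst (q ℕ.∣_) (sym eq) (ℕ.m∣m*n (product qs))

m≤n⇒m∣n! : ∀ {m n} .{{_ : NonZero m}} → m ≤ n → m ℕ.∣ n !
m≤n⇒m∣n! {suc m} m≤n = ℕ.∣-trans (ℕ.m∣m*n (m !)) (ℕ.m≤n⇒m!∣n! m≤n)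

-- Euclid's argument: a prime divisor of N! + 1 below N would divide 1.
unboundedPrimes : ∀ N → ∃[ q ] (Prime q × N ≤ q)
unboundedPrimes N with prime-divisor (suc (N !)) (s≤s (ℕ.1≤n! N))
... | q , q-prime , q∣ with N ℕ.≤? q
...   | yes N≤q = q , q-prime , N≤q
...   | no  N≰q = contradiction (subst Prime q≡1 q-prime) ¬prime[1]
  where
  q∣N! : q ℕ.∣ N !
  q∣N! = m≤n⇒m∣n! {{prime⇒nonZero q-prime}} (ℕ.<⇒≤ (ℕ.≰⇒> N≰q))
  q≡1 : q ≡ 1
  q≡1 = ℕ.∣1⇒≡1 (ℕ.∣m+n∣m⇒∣n (subst (q ℕ.∣_) (ℕ.+-comm 1 (N !)) q∣) q∣N!)

-- Cycle-freeness and the final estimate.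

module Acyclic (q : ℕ) .{{_ : NonZero q}} {ℓ} (P : Parameters ℓ) (q-prime : Prime q) where

  open Parameters P
  open Pairings q P q-prime
  open IncidenceGraph s t public using (graph; isRKPartition)
  open IncidenceGraph s t hiding (graph; isRKPartition)

  cycleFree : CycleFree graph (2 * ℓ)
  cycleFree with halves
  ... | inj₁ ℓ≡         = subst (λ l → CycleFree graph (2 * l)) (sym ℓ≡)
    (even-cycleFree m₀ TwoWalks.points-never-meet)
  ... | inj₂ (m<h , ℓ≡) = subst (λ l → CycleFree graph (2 * l)) (sym ℓ≡)
    (odd-cycleFree m₀ λ F G start → TwoWalks.lines-never-meet F G start m<h)

^-distribʳ-* : ∀ m n o → (m * n) ^ o ≡ m ^ o * n ^ o
^-distribʳ-* m n zero    = refl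
^-distribʳ-* m n (suc o) = trans (cong (m * n *_) (^-distribʳ-* m n o))
  (ℕ.[m*n]*[o*p]≡[m*o]*[n*p] m n (m ^ o) (n ^ o))

-- Meant for y = 3ℓ - 2, with parts of size 2 q^b and r = q^(b+1). Comparing exponents of q leaves b
-- (y + 4) ≤ (b + 1) y, that is, 4b ≤ y.
part-bound : ∀ q b y .{{_ : NonZero q}} → 4 * b ≤ y →
  (2 * q ^ b) ^ (y + 4) ≤ 2 ^ (y + 4) * (q ^ suc b) ^ y
part-bound q b y 4b≤y = begin
  (2 * q ^ b) ^ (y + 4)           ≡⟨ ^-distribʳ-* 2 (q ^ b) (y + 4) ⟩
  2 ^ (y + 4) * (q ^ b) ^ (y + 4) ≡⟨ cong (2 ^ (y + 4) *_) (ℕ.^-*-assoc q b (y + 4)) ⟩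
  2 ^ (y + 4) * q ^ (b * (y + 4))
    ≤⟨ ℕ.*-monoʳ-≤ (2 ^ (y + 4)) (ℕ.^-monoʳ-≤ q exponent) ⟩
  2 ^ (y + 4) * q ^ (suc b * y)   ≡⟨ cong (2 ^ (y + 4) *_) (ℕ.^-*-assoc q (suc b) y) ⟨
  2 ^ (y + 4) * (q ^ suc b) ^ y   ∎
  where
  open ℕ.≤-Reasoning
  exponent : b * (y + 4) ≤ suc b * y
  exponent = begin
    b * (y + 4)   ≡⟨ lemma b y ⟩
    4 * b + b * y ≤⟨ ℕ.+-monoˡ-≤ (b * y) 4b≤y ⟩
    suc b * y     ∎
    where
    lemma : ∀ b y → b * (y + 4) ≡ 4 * b + b * y
    lemma = solve-∀

theorem1p6 : ∀ (ℓ : ℕ) → 2 ≤ ℓ →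
    ∃[ C ] (1 ≤ C × (∀ (N : ℕ) → ∃[ r ] (N ≤ r × 1 ≤ r ×
    ∃[ k ] (ExistsCycleFreeRKGraph r k (2 * ℓ)
    × k ^ (3 * ℓ + 2) ≤ C * r ^ (3 * ℓ ∸ 2) * ⌊log₂ r ⌋ ^ (3 * ℓ)))))
-- The constant absorbs the factor 2 of the part size 2 q^b, raised to the power 3ℓ + 2.
theorem1p6 ℓ@(suc (suc ℓ₀)) (s≤s (s≤s _)) = 2 ^ (3 * ℓ + 2) , ℕ.^-monoʳ-≤ 2 {0} {3 * ℓ + 2} z≤n , λ N →
  let q , q-prime , N≤q = unboundedPrimes N in construction N q q-prime N≤q
  where
  P = parameters ℓ₀
  open Parameters P using (m₀; c; size)
  construction : ∀ N q → Prime q → N ≤ q → ∃[ r ] (N ≤ r × 1 ≤ r ×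
    ∃[ k ] (ExistsCycleFreeRKGraph r k (2 * ℓ)
    × k ^ (3 * ℓ + 2) ≤ 2 ^ (3 * ℓ + 2) * r ^ (3 * ℓ ∸ 2) * ⌊log₂ r ⌋ ^ (3 * ℓ)))
  construction N q q-prime N≤q =
    r , ℕ.≤-trans N≤q q≤r , ℕ.≤-trans (ℕ.>-nonZero⁻¹ q) q≤r ,
    2 * q ^ b , (_ , graph , cycleFree , _ , isRKPartition) , bound
    where
    instance _ = prime⇒nonZero q-prime
    open Acyclic q P q-prime
    b = m₀ + c
    r = q ^ suc b
    y = 3 * ℓ ∸ 2
    q≤r : q ≤ r
    q≤r = ℕ.≤-trans (ℕ.≤-reflexive (sym (ℕ.^-identityʳ q))) (ℕ.^-monoʳ-≤ q {1} {suc b} (s≤s z≤n))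
    3ℓ+2≡y+4 : 3 * ℓ + 2 ≡ y + 4
    3ℓ+2≡y+4 = trans (cong (_+ 2) (sym (ℕ.m∸n+n≡m {3 * ℓ} {2} (s≤s (s≤s z≤n))))) (ℕ.+-assoc y 2 2)
    4b≤y : 4 * b ≤ y
    4b≤y = ℕ.+-cancelʳ-≤ 4 _ _
      (ℕ.≤-trans (ℕ.≤-reflexive (lemma b)) (ℕ.≤-trans size (ℕ.≤-reflexive 3ℓ+2≡y+4)))
      where
      lemma : ∀ b → 4 * b + 4 ≡ 4 * suc b
      lemma = solve-∀
    -- Since r ≥ q ≥ 2, the logarithmic factor is at least 1 and can be multiplied in.
    1≤log : 1 ≤ ⌊log₂ r ⌋
    1≤log = ⌊log₂⌋-mono-≤ {2} (ℕ.≤-trans (ℕ.nonTrivial⇒n>1 q {{prime⇒nonTrivial q-prime}}) q≤r)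
    bound : (2 * q ^ b) ^ (3 * ℓ + 2) ≤ 2 ^ (3 * ℓ + 2) * r ^ y * ⌊log₂ r ⌋ ^ (3 * ℓ)
    bound = begin
      (2 * q ^ b) ^ (3 * ℓ + 2)
        ≤⟨ subst (λ e → (2 * q ^ b) ^ e ≤ 2 ^ e * r ^ y) (sym 3ℓ+2≡y+4) (part-bound q b y 4b≤y) ⟩
      2 ^ (3 * ℓ + 2) * r ^ y
        ≡⟨ ℕ.*-identityʳ _ ⟨
      2 ^ (3 * ℓ + 2) * r ^ y * 1
        ≡⟨ cong (2 ^ (3 * ℓ + 2) * r ^ y *_) (ℕ.^-zeroˡ (3 * ℓ)) ⟨
      2 ^ (3 * ℓ + 2) * r ^ y * 1 ^ (3 * ℓ)
        ≤⟨ ℕ.*-monoʳ-≤ (2 ^ (3 * ℓ + 2) * r ^ y) (ℕ.^-monoˡ-≤ (3 * ℓ) 1≤log) ⟩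
      2 ^ (3 * ℓ + 2) * r ^ y * ⌊log₂ r ⌋ ^ (3 * ℓ) ∎
      where open ℕ.≤-Reasoning
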